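{- Let $G=\langle a,z\rangle$ be a group with rotary pair $(a,z)$, and let $H=\langle a\rangle$ and $J=\langle z\rangle\cong\mathbb Z_2$. Then $\Gamma:=\mathrm{Cos}(G,H,J)$ is a $G$-vertex-rotary graph of valency $k:=|H:H\cap H^z|$ and edge-multiplicity $\lambda:=|H\cap H^z|$, and $|a|=k\lambda$. Further, if $|a|\ge3$ and $H\ne H^z$, then $\Gamma$ is not $\mathbf K_2^{(\lambda)}$ and $\Gamma$ is not a simple cycle.
   Context: A rotary pair for $G$ is $(a,z)$ with $G=\langle a,z\rangle$, $|a|$ finite, $|z|=2$, $z\notin\langle a\rangle$. $\mathrm{Cos}(G,H,J)$ is the graph with vertex set $[G:H]$, edge set $[G:J]$ (right cosets), $Hx$ incident with $Jy$ iff $yx^{ -1}\in JH$, with $G$ acting by right multiplication. Graphs: each edge incident with two distinct vertices, multiple edges allowed; valency = number of neighbours of a vertex; edge-multiplicity = number of edges joining two adjacent vertices. $G$-vertex-rotary: $G$ acts by automorphisms transitively on arcs (edges with an ordering of their vertices) and the stabiliser of a vertex $\alpha$ induces a transitive cyclic group on the set of edges incident with $\alpha$. $\mathbf K_2^{(\lambda)}$: two vertices joined by $\lambda$ edges. Simple cycle: the simple graph $\mathbf C_n$, $n\ge3$. $H^z=z^{ -1}Hz$. -}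

module Defs where

open import Level using (Level; _⊔_; 0ℓ; Lift) renaming (suc to lsuc)
open import Algebra.Bundles using (Group)
open import Data.Nat using (ℕ; zero; suc; _≤_; _<_)
open import Data.Integer using (ℤ; +_; -[1+_])
open import Data.Fin using (Fin; toℕ)
open import Data.Product using (Σ; ∃; ∃₂; _×_; _,_)
open import Data.Sum using (_⊎_)
open import Data.Unit using (⊤)
open import Relation.Nullary using (¬_)
open import Relation.Binary.PropositionalEquality using (_≡_)

HasExactly : {a b p : Level} {A : Set a} (_~_ : A → A → Set b)
             (P : A → Set p) (n : ℕ) → Set (a ⊔ b ⊔ p)
HasExactly {A = A} _~_ P n =
  Σ (Fin n → A) λ f →
    (∀ i → P (f i)) ×
    (∀ i j → f i ~ f j → i ≡ j) ×
    (∀ x → P x → ∃ λ i → x ~ f i)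

-- Graphs (multigraphs) as incidence structures: vertices and edges are
-- given by representatives together with the relation "same vertex" /
-- "same edge" (needed for coset graphs), and an incidence relation.

record Graph (a b : Level) : Set (lsuc (a ⊔ b)) where
  field
    Vtx   : Set a
    Edg   : Set a
    _≈V_  : Vtx → Vtx → Set b
    _≈E_  : Edg → Edg → Set b
    _inc_ : Vtx → Edg → Set b

module _ {a b : Level} (Γ : Graph a b) where
  open Graph Γ

  IsProperGraph : Set (a ⊔ b)
  IsProperGraph = ∀ e → ∃₂ λ u v → ¬ (u ≈V v) × u inc e × v inc e ×
                        (∀ w → w inc e → (w ≈V u) ⊎ (w ≈V v))

  Adjacent : Vtx → Vtx → Set (a ⊔ b)
  Adjacent u v = ¬ (u ≈V v) × ∃ λ e → u inc e × v inc e

  HasValency : ℕ → Set (a ⊔ b)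
  HasValency k = ∀ u → HasExactly _≈V_ (Adjacent u) k

  HasEdgeMultiplicity : ℕ → Set (a ⊔ b)
  HasEdgeMultiplicity m =
    ∀ u v → Adjacent u v → HasExactly _≈E_ (λ e → u inc e × v inc e) m

record _≅_ {a b a' b' : Level} (Γ : Graph a b) (Δ : Graph a' b')
       : Set (a ⊔ b ⊔ a' ⊔ b') where
  private
    module Γ = Graph Γ
    module Δ = Graph Δ
  field
    fV      : Γ.Vtx → Δ.Vtx
    fE      : Γ.Edg → Δ.Edg
    fV-resp : ∀ u v → u Γ.≈V v → fV u Δ.≈V fV v
    fV-refl : ∀ u v → fV u Δ.≈V fV v → u Γ.≈V v
    fV-surj : ∀ v' → ∃ λ v → fV v Δ.≈V v'
    fE-resp : ∀ e f → e Γ.≈E f → fE e Δ.≈E fE f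
    fE-refl : ∀ e f → fE e Δ.≈E fE f → e Γ.≈E f
    fE-surj : ∀ e' → ∃ λ e → fE e Δ.≈E e'
    inc-pres : ∀ u e → u Γ.inc e → fV u Δ.inc fE e
    inc-refl : ∀ u e → fV u Δ.inc fE e → u Γ.inc e

K2 : ℕ → Graph 0ℓ 0ℓ
K2 m = record
  { Vtx = Fin 2 ; Edg = Fin m ; _≈V_ = _≡_ ; _≈E_ = _≡_
  ; _inc_ = λ _ _ → ⊤ }

-- the cycle on n vertices: edge e joins vertices e and e+1 (mod n)
Cycle : ℕ → Graph 0ℓ 0ℓ
Cycle n = record
  { Vtx = Fin n ; Edg = Fin n ; _≈V_ = _≡_ ; _≈E_ = _≡_
  ; _inc_ = λ v e → (v ≡ e) ⊎ (toℕ v ≡ suc (toℕ e)) ⊎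
                    ((toℕ v ≡ 0) × (suc (toℕ e) ≡ n)) }

IsSimpleCycle : {a b : Level} → Graph a b → Set (a ⊔ b)
IsSimpleCycle Γ = ∃ λ n → 3 ≤ n × (Γ ≅ Cycle n)

module GroupDefs {c ℓ : Level} (G : Group c ℓ) where
  open Group G

  infixr 8 _^ℕ_ _^ℤ_
  _^ℕ_ : Carrier → ℕ → Carrier
  g ^ℕ zero  = ε
  g ^ℕ suc n = g ∙ (g ^ℕ n)

  _^ℤ_ : Carrier → ℤ → Carrier
  g ^ℤ (+ n)     = g ^ℕ n
  g ^ℤ -[1+ n ]  = (g ⁻¹) ^ℕ suc n

  HasOrder : Carrier → ℕ → Set ℓ
  HasOrder g n = 1 ≤ n × (g ^ℕ n ≈ ε) ×
                 (∀ m → 1 ≤ m → m < n → ¬ (g ^ℕ m ≈ ε))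

  ⟨_⟩ : Carrier → Carrier → Set ℓ
  ⟨ g ⟩ x = ∃ λ (i : ℤ) → x ≈ g ^ℤ i

  data Gen2 (a z : Carrier) : Carrier → Set (c ⊔ ℓ) where
    gen-a   : Gen2 a z a
    gen-z   : Gen2 a z z
    gen-ε   : Gen2 a z ε
    gen-∙   : ∀ {x y} → Gen2 a z x → Gen2 a z y → Gen2 a z (x ∙ y)
    gen-⁻¹  : ∀ {x} → Gen2 a z x → Gen2 a z (x ⁻¹)
    gen-≈   : ∀ {x y} → x ≈ y → Gen2 a z x → Gen2 a z y

  IsRotaryPair : Carrier → Carrier → Set (c ⊔ ℓ)
  IsRotaryPair a z = (∀ x → Gen2 a z x) × (∃ λ n → HasOrder a n) ×
                     HasOrder z 2 × ¬ (⟨ a ⟩ z)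

  Conj : {p : Level} → (Carrier → Set p) → Carrier → Carrier → Set (c ⊔ ℓ ⊔ p)
  Conj H z x = ∃ λ h → H h × (x ≈ (z ⁻¹ ∙ h) ∙ z)

  CapConj : {p : Level} → (Carrier → Set p) → Carrier → Carrier → Set (c ⊔ ℓ ⊔ p)
  CapConj H z x = H x × Conj H z x

  SameAsConj : {p : Level} → (Carrier → Set p) → Carrier → Set (c ⊔ ℓ ⊔ p)
  SameAsConj H z = ∀ x → (H x → Conj H z x) × (Conj H z x → H x)

  -- K x = K y  (right cosets)
  SameRightCoset : {p : Level} → (Carrier → Set p) → Carrier → Carrier → Set p
  SameRightCoset K x y = K (x ∙ y ⁻¹)

  InProd : (Carrier → Set ℓ) → (Carrier → Set ℓ) → Carrier → Set (c ⊔ ℓ)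
  InProd J H x = ∃₂ λ j h → J j × H h × (x ≈ j ∙ h)

  -- the coset graph Cos(G,H,J): vertices H x, edges J y (represented by
  -- x, y ∈ G), and H x incident with J y iff y x⁻¹ ∈ J H
  Cos : (Carrier → Set ℓ) → (Carrier → Set ℓ) → Graph c (c ⊔ ℓ)
  Cos H J = record
    { Vtx   = Carrier
    ; Edg   = Carrier
    ; _≈V_  = λ x y → Lift c (SameRightCoset H x y)
    ; _≈E_  = λ x y → Lift c (SameRightCoset J x y)
    ; _inc_ = λ x y → InProd J H (y ∙ x ⁻¹)
    }

module _ {a b c ℓ : Level} (Γ : Graph a b) (G : Group c ℓ) where
  open Graph Γ
  open Group G
  open GroupDefs G

  module _ (actV : Vtx → Carrier → Vtx) (actE : Edg → Carrier → Edg) where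

    IsAutAction : Set (a ⊔ b ⊔ c)
    IsAutAction =
      (∀ u → actV u ε ≈V u) ×
      (∀ u g h → actV (actV u g) h ≈V actV u (g ∙ h)) ×
      (∀ e → actE e ε ≈E e) ×
      (∀ e g h → actE (actE e g) h ≈E actE e (g ∙ h)) ×
      (∀ g u v → u ≈V v → actV u g ≈V actV v g) ×
      (∀ g e f → e ≈E f → actE e g ≈E actE f g) ×
      (∀ g u e → (u inc e → actV u g inc actE e g) ×
                 (actV u g inc actE e g → u inc e))

    IsArcTransitive : Set (a ⊔ b ⊔ c)
    IsArcTransitive =
      ∀ e u v e' u' v' →
        u inc e → v inc e → ¬ (u ≈V v) →
        u' inc e' → v' inc e' → ¬ (u' ≈V v') →
        ∃ λ g → (actE e g ≈E e') × (actV u g ≈V u') × (actV v g ≈V v')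

    -- the stabiliser G_α induces a transitive cyclic group on the edges
    -- incident with α: transitive, and generated by the image of one g₀ ∈ G_α
    IsStabCyclicTransitive : Set (a ⊔ b ⊔ c)
    IsStabCyclicTransitive =
      ∀ α →
        (∀ e e' → α inc e → α inc e' →
           ∃ λ g → (actV α g ≈V α) × (actE e g ≈E e')) ×
        (∃ λ g₀ → (actV α g₀ ≈V α) ×
           (∀ g → actV α g ≈V α →
              ∃ λ (m : ℤ) → ∀ e → α inc e → actE e g ≈E actE e (g₀ ^ℤ m)))

    IsVertexRotary : Set (a ⊔ b ⊔ c)
    IsVertexRotary = IsAutAction × IsArcTransitive × IsStabCyclicTransitive

{-# OPTIONS --safe #-}
-- Write H = ⟨a⟩, J = ⟨z⟩ = {1, z}. The edge Jy of Γ = Cos(G, H, J) is incident exactly with the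
-- vertices Hy and Hzy, which differ since z ∉ H. Every arc can be written as (Jy ; Hy, Hzy), so
-- right multiplication by y⁻¹y′ carries one arc onto another; the stabiliser of the vertex Hx is
-- the cyclic group x⁻¹Hx, and it is transitive on the edges Jhx (h ∈ H) at Hx. The neighbours of
-- Hx are the vertices Hzhx, and Hzhx = Hzh′x iff hh′⁻¹ ∈ Hᶻ, which gives valency |H : H ∩ Hᶻ|;
-- the edges joining Hx and Hzhx are Jκhx for κ ∈ H ∩ Hᶻ, which gives multiplicity |H ∩ Hᶻ|, and
-- |a| = kλ is Lagrange's theorem for H ∩ Hᶻ ≤ H. If Γ ≅ K₂^(λ) then G = H ∪ Hz, so H is normal
-- and H = Hᶻ; if |a| ≥ 3 the edges J, Ja, Ja² at the vertex H are distinct, so Γ is not a cycle.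
module Submission where

open import Defs
open import Level using (Level; _⊔_; lift; lower)
open import Algebra.Bundles using (Group)
open import Data.Bool using (Bool; true; false; not; _∧_; _xor_; if_then_else_)
open import Data.Fin using (Fin; zero; suc; toℕ; fromℕ<; combine; remQuot; _≟_)
open import Data.Fin.Properties using (toℕ-injective; toℕ<n; toℕ-fromℕ<; combine-remQuot; remQuot-combine; injective⇒≤)
open import Data.Integer using (+_; -[1+_])
open import Data.List using (List; []; _∷_; _++_; [_])
open import Data.Nat using (ℕ; zero; suc; _+_; _*_; _∸_; _≤_; _<_; z<s; s<s; _%_; _/_)
open import Data.Nat.DivMod using (m≡m%n+[m/n]*n; m%n<n)
open import Data.Nat.Properties using (≤-antisym; suc-injective; <-cmp; m<n⇒0<n∸m; m∸n≤m; ≤-<-trans; m+[n∸m]≡n; <⇒≤; <-≤-trans)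
open import Data.Product using (∃; _×_; _,_; proj₁; proj₂; uncurry)
open import Data.Sum as Sum using (_⊎_; inj₁; inj₂)
open import Data.Vec using (Vec; lookup)
open import Function using (_∘_)
open import Relation.Binary.Bundles using (Setoid)
open import Relation.Binary.Definitions using (tri<; tri≈; tri>)
open import Relation.Binary.PropositionalEquality as ≡ using (_≡_; _≢_)
open import Relation.Nullary using (¬_; contradiction)
open import Relation.Nullary.Decidable using (⌊_⌋; yes; no)
import Algebra.Properties.Group as GroupProperties
import Algebra.Properties.Monoid as MonoidProperties
import Relation.Binary.Reasoning.Setoid as SetoidReasoning
import Relation.Binary.Reflection as Reflection

module GroupSolver {c ℓ : Level} (G : Group c ℓ) where
  open Group G
  open GroupProperties G
  open MonoidProperties monoid using (insertˡ)
  open SetoidReasoning setoid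

  infixl 7 _:∙_
  infix 8 _:⁻¹

  data Expr (n : ℕ) : Set where
    var   : Fin n → Expr n
    _:∙_  : Expr n → Expr n → Expr n
    _:⁻¹  : Expr n → Expr n
    :ε    : Expr n

  -- A letter (i , false) stands for the inverse of the i-th variable.
  Letter : ℕ → Set
  Letter n = Fin n × Bool

  Word : ℕ → Set
  Word n = List (Letter n)

  invert : ∀ {n} → Word n → Word n
  invert []            = []
  invert ((i , b) ∷ w) = invert w ++ [ i , not b ]

  flatten : ∀ {n} → Expr n → Word n
  flatten (var i)  = [ i , true ]
  flatten (e :∙ f) = flatten e ++ flatten f
  flatten (e :⁻¹)  = invert (flatten e)
  flatten :ε       = []

  cancels : ∀ {n} → Letter n → Letter n → Bool
  cancels (i , b) (j , b′) = ⌊ i ≟ j ⌋ ∧ (b xor b′)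

  cons : ∀ {n} → Letter n → Word n → Word n
  cons l []       = [ l ]
  cons l (l′ ∷ w) = if cancels l l′ then w else l ∷ l′ ∷ w

  reduce : ∀ {n} → Word n → Word n
  reduce []      = []
  reduce (l ∷ w) = cons l (reduce w)

  module _ {n : ℕ} (ρ : Vec Carrier n) where

    ⟦_⟧ : Expr n → Carrier
    ⟦ var i ⟧  = lookup ρ i
    ⟦ e :∙ f ⟧ = ⟦ e ⟧ ∙ ⟦ f ⟧
    ⟦ e :⁻¹ ⟧  = ⟦ e ⟧ ⁻¹
    ⟦ :ε ⟧     = ε

    ⟦_⟧L : Letter n → Carrier
    ⟦ i , true ⟧L  = lookup ρ i
    ⟦ i , false ⟧L = lookup ρ i ⁻¹

    ⟦_⟧W : Word n → Carrier
    ⟦ [] ⟧W    = ε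
    ⟦ l ∷ w ⟧W = ⟦ l ⟧L ∙ ⟦ w ⟧W

    ⟦++⟧ : ∀ v w → ⟦ v ++ w ⟧W ≈ ⟦ v ⟧W ∙ ⟦ w ⟧W
    ⟦++⟧ []      w = sym (identityˡ _)
    ⟦++⟧ (l ∷ v) w = trans (∙-congˡ (⟦++⟧ v w)) (sym (assoc _ _ _))

    ⟦not⟧ : ∀ i b → ⟦ i , not b ⟧L ≈ ⟦ i , b ⟧L ⁻¹
    ⟦not⟧ i true  = refl
    ⟦not⟧ i false = sym (⁻¹-involutive _)

    ⟦invert⟧ : ∀ w → ⟦ invert w ⟧W ≈ ⟦ w ⟧W ⁻¹
    ⟦invert⟧ []            = sym ε⁻¹≈ε
    ⟦invert⟧ ((i , b) ∷ w) = begin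
      ⟦ invert w ++ [ i , not b ] ⟧W       ≈⟨ ⟦++⟧ (invert w) _ ⟩
      ⟦ invert w ⟧W ∙ (⟦ i , not b ⟧L ∙ ε) ≈⟨ ∙-cong (⟦invert⟧ w) (trans (identityʳ _) (⟦not⟧ i b)) ⟩
      ⟦ w ⟧W ⁻¹ ∙ ⟦ i , b ⟧L ⁻¹            ≈⟨ ⁻¹-anti-homo-∙ _ _ ⟨
      (⟦ i , b ⟧L ∙ ⟦ w ⟧W) ⁻¹             ∎

    ⟦flatten⟧ : ∀ e → ⟦ flatten e ⟧W ≈ ⟦ e ⟧
    ⟦flatten⟧ (var i)  = identityʳ _
    ⟦flatten⟧ (e :∙ f) = trans (⟦++⟧ (flatten e) _) (∙-cong (⟦flatten⟧ e) (⟦flatten⟧ f))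
    ⟦flatten⟧ (e :⁻¹)  = trans (⟦invert⟧ (flatten e)) (⁻¹-cong (⟦flatten⟧ e))
    ⟦flatten⟧ :ε       = refl

    ⟦cancel⟧ : ∀ l l′ w → cancels l l′ ≡ true → ⟦ w ⟧W ≈ ⟦ l ⟧L ∙ (⟦ l′ ⟧L ∙ ⟦ w ⟧W)
    ⟦cancel⟧ (i , b) (j , b′) w eq with i ≟ j
    ⟦cancel⟧ (i , true)  (.i , false) w eq | yes ≡.refl = insertˡ (inverseʳ _) _
    ⟦cancel⟧ (i , false) (.i , true)  w eq | yes ≡.refl = insertˡ (inverseˡ _) _
    ⟦cancel⟧ (i , true)  (.i , true)  w () | yes ≡.refl
    ⟦cancel⟧ (i , false) (.i , false) w () | yes ≡.refl
    ⟦cancel⟧ (i , b)     (j , b′)     w () | no _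

    ⟦cons⟧ : ∀ l w → ⟦ cons l w ⟧W ≈ ⟦ l ⟧L ∙ ⟦ w ⟧W
    ⟦cons⟧ l []       = refl
    ⟦cons⟧ l (l′ ∷ w) with cancels l l′ in eq
    ... | true  = ⟦cancel⟧ l l′ w eq
    ... | false = refl

    ⟦reduce⟧ : ∀ w → ⟦ reduce w ⟧W ≈ ⟦ w ⟧W
    ⟦reduce⟧ []      = refl
    ⟦reduce⟧ (l ∷ w) = trans (⟦cons⟧ l (reduce w)) (∙-congˡ (⟦reduce⟧ w))

  ⟦_⇓⟧ : ∀ {n} → Expr n → Vec Carrier n → Carrier
  ⟦ e ⇓⟧ ρ = ⟦_⟧W ρ (reduce (flatten e))

  open Reflection setoid var (λ e ρ → ⟦_⟧ ρ e) ⟦_⇓⟧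
    (λ e ρ → trans (⟦reduce⟧ ρ (flatten e)) (⟦flatten⟧ ρ e)) public
    using (solve; _⊜_)

module GroupLemmas {c ℓ : Level} (G : Group c ℓ) where
  open Group G
  open GroupDefs G
  open GroupProperties G
  open GroupSolver G
  open SetoidReasoning setoid

  ^ℕ-cong : ∀ n {x y} → x ≈ y → x ^ℕ n ≈ y ^ℕ n
  ^ℕ-cong zero    _   = refl
  ^ℕ-cong (suc n) x≈y = ∙-cong x≈y (^ℕ-cong n x≈y)

  ^ℕ-+ : ∀ g i j → g ^ℕ (i + j) ≈ g ^ℕ i ∙ g ^ℕ j
  ^ℕ-+ g zero    j = sym (identityˡ _)
  ^ℕ-+ g (suc i) j = trans (∙-congˡ (^ℕ-+ g i j)) (sym (assoc _ _ _))

  ^ℕ-* : ∀ g i j → g ^ℕ (i * j) ≈ (g ^ℕ j) ^ℕ i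
  ^ℕ-* g zero    j = refl
  ^ℕ-* g (suc i) j = trans (^ℕ-+ g j (i * j)) (∙-congˡ (^ℕ-* g i j))

  ε^ℕ : ∀ n → ε ^ℕ n ≈ ε
  ε^ℕ zero    = refl
  ε^ℕ (suc n) = trans (identityˡ _) (ε^ℕ n)

  ^ℕ-comm : ∀ g n → g ∙ g ^ℕ n ≈ g ^ℕ n ∙ g
  ^ℕ-comm g zero    = trans (identityʳ g) (sym (identityˡ g))
  ^ℕ-comm g (suc n) = trans (∙-congˡ (^ℕ-comm g n)) (sym (assoc _ _ _))

  ^ℕ-⁻¹ : ∀ g n → (g ^ℕ n) ⁻¹ ≈ (g ⁻¹) ^ℕ n
  ^ℕ-⁻¹ g zero    = ε⁻¹≈ε
  ^ℕ-⁻¹ g (suc n) = begin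
    (g ∙ g ^ℕ n) ⁻¹     ≈⟨ ⁻¹-anti-homo-∙ g (g ^ℕ n) ⟩
    (g ^ℕ n) ⁻¹ ∙ g ⁻¹  ≈⟨ ∙-congʳ (^ℕ-⁻¹ g n) ⟩
    (g ⁻¹) ^ℕ n ∙ g ⁻¹  ≈⟨ ^ℕ-comm (g ⁻¹) n ⟨
    g ⁻¹ ∙ (g ⁻¹) ^ℕ n  ∎

  ^ℕ-conj : ∀ x g n → ((x ⁻¹ ∙ g) ∙ x) ^ℕ n ≈ (x ⁻¹ ∙ g ^ℕ n) ∙ x
  ^ℕ-conj x g zero    = sym (trans (∙-congʳ (identityʳ _)) (inverseˡ x))
  ^ℕ-conj x g (suc n) = trans (∙-congˡ (^ℕ-conj x g n))
    (solve 3 (λ x g h → ((x :⁻¹ :∙ g) :∙ x) :∙ ((x :⁻¹ :∙ h) :∙ x) ⊜ (x :⁻¹ :∙ (g :∙ h)) :∙ x)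
           refl x g (g ^ℕ n))

  ^ℤ-conj : ∀ x g i → ((x ⁻¹ ∙ g) ∙ x) ^ℤ i ≈ (x ⁻¹ ∙ g ^ℤ i) ∙ x
  ^ℤ-conj x g (+ n)    = ^ℕ-conj x g n
  ^ℤ-conj x g -[1+ n ] = trans
    (^ℕ-cong (suc n) (solve 2 (λ x g → ((x :⁻¹ :∙ g) :∙ x) :⁻¹ ⊜ (x :⁻¹ :∙ g :⁻¹) :∙ x) refl x g))
    (^ℕ-conj x (g ⁻¹) (suc n))

  ^ℕ-cancelˡ : ∀ g i d → g ^ℕ i ≈ g ^ℕ (i + d) → g ^ℕ d ≈ ε
  ^ℕ-cancelˡ g i d gⁱ≈gⁱ⁺ᵈ = begin
    g ^ℕ d                         ≈⟨ solve 2 (λ x y → y ⊜ x :⁻¹ :∙ (x :∙ y)) refl (g ^ℕ i) (g ^ℕ d) ⟩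
    (g ^ℕ i) ⁻¹ ∙ (g ^ℕ i ∙ g ^ℕ d) ≈⟨ ∙-congˡ (^ℕ-+ g i d) ⟨
    (g ^ℕ i) ⁻¹ ∙ g ^ℕ (i + d)      ≈⟨ ∙-congˡ gⁱ≈gⁱ⁺ᵈ ⟨
    (g ^ℕ i) ⁻¹ ∙ g ^ℕ i            ≈⟨ inverseˡ _ ⟩
    ε                              ∎

  ^ℕ-distinct : ∀ {g n i j} → HasOrder g n → i < j → j < n → ¬ g ^ℕ i ≈ g ^ℕ j
  ^ℕ-distinct {g} {n} {i} {j} (_ , _ , minimal) i<j j<n gⁱ≈gʲ =
    minimal (j ∸ i) (m<n⇒0<n∸m i<j) (≤-<-trans (m∸n≤m j i) j<n)
      (^ℕ-cancelˡ g i (j ∸ i) (trans gⁱ≈gʲ (reflexive (≡.cong (g ^ℕ_) (≡.sym (m+[n∸m]≡n (<⇒≤ i<j)))))))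

  ^ℕ-injective : ∀ {g n i j} → HasOrder g n → i < n → j < n → g ^ℕ i ≈ g ^ℕ j → i ≡ j
  ^ℕ-injective {i = i} {j} ord i<n j<n gⁱ≈gʲ with <-cmp i j
  ... | tri< i<j _ _ = contradiction gⁱ≈gʲ (^ℕ-distinct ord i<j j<n)
  ... | tri≈ _ i≡j _ = i≡j
  ... | tri> _ _ j<i = contradiction (sym gⁱ≈gʲ) (^ℕ-distinct ord j<i i<n)

  ^ℕ-reduce : ∀ {g n} → HasOrder g n → ∀ t → ∃ λ (r : Fin n) → g ^ℕ t ≈ g ^ℕ toℕ r
  ^ℕ-reduce {g} {suc n} (_ , gⁿ≈ε , _) t = fromℕ< (m%n<n t (suc n)) , (begin
    g ^ℕ t                                           ≡⟨ ≡.cong (g ^ℕ_) (m≡m%n+[m/n]*n t (suc n)) ⟩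
    g ^ℕ (t % suc n + t / suc n * suc n)             ≈⟨ ^ℕ-+ g (t % suc n) (t / suc n * suc n) ⟩
    g ^ℕ (t % suc n) ∙ g ^ℕ (t / suc n * suc n)      ≈⟨ ∙-congˡ (^ℕ-* g (t / suc n) (suc n)) ⟩
    g ^ℕ (t % suc n) ∙ (g ^ℕ suc n) ^ℕ (t / suc n)   ≈⟨ ∙-congˡ (trans (^ℕ-cong (t / suc n) gⁿ≈ε) (ε^ℕ (t / suc n))) ⟩
    g ^ℕ (t % suc n) ∙ ε                             ≈⟨ identityʳ _ ⟩
    g ^ℕ (t % suc n)                                 ≡⟨ ≡.cong (g ^ℕ_) (toℕ-fromℕ< (m%n<n t (suc n))) ⟨
    g ^ℕ toℕ (fromℕ< (m%n<n t (suc n)))              ∎)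

  ^ℤ⇒^ℕ : ∀ {g n} → HasOrder g n → ∀ i → ∃ λ t → g ^ℤ i ≈ g ^ℕ t
  ^ℤ⇒^ℕ ord (+ t) = t , refl
  ^ℤ⇒^ℕ {g} {suc n} (_ , gⁿ⁺¹≈ε , _) -[1+ t ] = suc t * n , (begin
    (g ⁻¹) ^ℕ suc t    ≈⟨ ^ℕ-cong (suc t) (inverseʳ-unique g (g ^ℕ n) gⁿ⁺¹≈ε) ⟨
    (g ^ℕ n) ^ℕ suc t  ≈⟨ ^ℕ-* g (suc t) n ⟨
    g ^ℕ (suc t * n)   ∎)

  ⟨⟩⇒^ℕ : ∀ {g n x} → HasOrder g n → ⟨ g ⟩ x → ∃ λ t → x ≈ g ^ℕ t
  ⟨⟩⇒^ℕ ord (i , x≈gⁱ) = let (t , gⁱ≈gᵗ) = ^ℤ⇒^ℕ ord i in t , trans x≈gⁱ gⁱ≈gᵗ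

  record IsSubgroup {p : Level} (S : Carrier → Set p) : Set (c ⊔ ℓ ⊔ p) where
    field
      ∈-resp-≈  : ∀ {x y} → x ≈ y → S x → S y
      ε-∈       : S ε
      ∙-closed  : ∀ {x y} → S x → S y → S (x ∙ y)
      ⁻¹-closed : ∀ {x} → S x → S (x ⁻¹)

    infix 4 _~_
    _~_ : Carrier → Carrier → Set p
    _~_ = SameRightCoset S

    ≈ε⇒∈ : ∀ {x} → x ≈ ε → S x
    ≈ε⇒∈ x≈ε = ∈-resp-≈ (sym x≈ε) ε-∈

    ~-reflexive : ∀ {x y} → x ≈ y → x ~ y
    ~-reflexive {x} {y} x≈y = ≈ε⇒∈ (trans (∙-congʳ x≈y) (inverseʳ y))

    ~-sym : ∀ {x y} → x ~ y → y ~ x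
    ~-sym {x} {y} = ∈-resp-≈ (solve 2 (λ x y → (x :∙ y :⁻¹) :⁻¹ ⊜ y :∙ x :⁻¹) refl x y) ∘ ⁻¹-closed

    ~-trans : ∀ {x y w} → x ~ y → y ~ w → x ~ w
    ~-trans {x} {y} {w} x~y y~w = ∈-resp-≈
      (solve 3 (λ x y w → (x :∙ y :⁻¹) :∙ (y :∙ w :⁻¹) ⊜ x :∙ w :⁻¹) refl x y w) (∙-closed x~y y~w)

    ~-resp : ∀ {x x′ y y′} → x ≈ x′ → y ≈ y′ → x ~ y → x′ ~ y′
    ~-resp x≈x′ y≈y′ = ∈-resp-≈ (∙-cong x≈x′ (⁻¹-cong y≈y′))

    ~-∙ʳ : ∀ {x y} g → x ~ y → x ∙ g ~ y ∙ g
    ~-∙ʳ {x} {y} g = ∈-resp-≈ (solve 3 (λ x y g → x :∙ y :⁻¹ ⊜ (x :∙ g) :∙ (y :∙ g) :⁻¹) refl x y g)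

    ∈⇒∙~ : ∀ {s} x → S s → s ∙ x ~ x
    ∈⇒∙~ {s} x = ∈-resp-≈ (solve 2 (λ s x → s ⊜ (s :∙ x) :∙ x :⁻¹) refl s x)

    ~-translate : ∀ {x y x′ y′} g → x ~ y → x′ ~ y′ → y ∙ g ≈ y′ → x ∙ g ~ x′
    ~-translate g x~y x′~y′ yg≈y′ = ~-trans (~-∙ʳ g x~y) (~-trans (~-reflexive yg≈y′) (~-sym x′~y′))

  ∩-isSubgroup : ∀ {p q} {S : Carrier → Set p} {T : Carrier → Set q} →
                 IsSubgroup S → IsSubgroup T → IsSubgroup (λ x → S x × T x)
  ∩-isSubgroup S-sub T-sub = record
    { ∈-resp-≈  = λ x≈y (s , t) → S.∈-resp-≈ x≈y s , T.∈-resp-≈ x≈y t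
    ; ε-∈       = S.ε-∈ , T.ε-∈
    ; ∙-closed  = λ (s , t) (s′ , t′) → S.∙-closed s s′ , T.∙-closed t t′
    ; ⁻¹-closed = λ (s , t) → S.⁻¹-closed s , T.⁻¹-closed t
    }
    where
    module S = IsSubgroup S-sub
    module T = IsSubgroup T-sub

  Conj-isSubgroup : ∀ {p} {S : Carrier → Set p} → IsSubgroup S → ∀ z → IsSubgroup (Conj S z)
  Conj-isSubgroup S-sub z = record
    { ∈-resp-≈  = λ x≈y (s , s∈S , x≈sᶻ) → s , s∈S , trans (sym x≈y) x≈sᶻ
    ; ε-∈       = ε , ε-∈ , solve 1 (λ z → :ε ⊜ (z :⁻¹ :∙ :ε) :∙ z) refl z
    ; ∙-closed  = λ (s , s∈S , x≈sᶻ) (t , t∈S , y≈tᶻ) → s ∙ t , ∙-closed s∈S t∈S ,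
        trans (∙-cong x≈sᶻ y≈tᶻ)
          (solve 3 (λ z s t → ((z :⁻¹ :∙ s) :∙ z) :∙ ((z :⁻¹ :∙ t) :∙ z) ⊜ (z :⁻¹ :∙ (s :∙ t)) :∙ z)
                 refl z s t)
    ; ⁻¹-closed = λ (s , s∈S , x≈sᶻ) → s ⁻¹ , ⁻¹-closed s∈S ,
        trans (⁻¹-cong x≈sᶻ) (solve 2 (λ z s → ((z :⁻¹ :∙ s) :∙ z) :⁻¹ ⊜ (z :⁻¹ :∙ s :⁻¹) :∙ z) refl z s)
    }
    where open IsSubgroup S-sub

  ⟨⟩-isSubgroup : ∀ {g n} → HasOrder g n → IsSubgroup ⟨ g ⟩
  ⟨⟩-isSubgroup {g} ord = record
    { ∈-resp-≈  = λ x≈y (i , x≈gⁱ) → i , trans (sym x≈y) x≈gⁱ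
    ; ε-∈       = + 0 , refl
    ; ∙-closed  = ∙-closed
    ; ⁻¹-closed = ⁻¹-closed
    }
    where
    ∙-closed : ∀ {x y} → ⟨ g ⟩ x → ⟨ g ⟩ y → ⟨ g ⟩ (x ∙ y)
    ∙-closed x∈ y∈ with ⟨⟩⇒^ℕ ord x∈ | ⟨⟩⇒^ℕ ord y∈
    ... | s , x≈gˢ | t , y≈gᵗ = + (s + t) , trans (∙-cong x≈gˢ y≈gᵗ) (sym (^ℕ-+ g s t))
    ⁻¹-closed : ∀ {x} → ⟨ g ⟩ x → ⟨ g ⟩ (x ⁻¹)
    ⁻¹-closed x∈ with ⟨⟩⇒^ℕ ord x∈
    ... | zero  , x≈ε  = + 0 , trans (⁻¹-cong x≈ε) ε⁻¹≈ε
    ... | suc t , x≈gᵗ = -[1+ t ] , trans (⁻¹-cong x≈gᵗ) (^ℕ-⁻¹ g (suc t))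

  ⟨⟩-hasExactly : ∀ {g n} → HasOrder g n → HasExactly _≈_ ⟨ g ⟩ n
  ⟨⟩-hasExactly {g} ord =
    (λ i → g ^ℕ toℕ i) ,
    (λ i → + toℕ i , refl) ,
    (λ i j gⁱ≈gʲ → toℕ-injective (^ℕ-injective ord (toℕ<n i) (toℕ<n j) gⁱ≈gʲ)) ,
    (λ x x∈⟨g⟩ → let (t , x≈gᵗ) = ⟨⟩⇒^ℕ ord x∈⟨g⟩ ; (r , gᵗ≈gʳ) = ^ℕ-reduce ord t
                 in r , trans x≈gᵗ gᵗ≈gʳ)

  module _ {z : Carrier} (z-order : HasOrder z 2) where

    order2⇒z∙z≈ε : z ∙ z ≈ ε
    order2⇒z∙z≈ε = trans (∙-congˡ (sym (identityʳ z))) (proj₁ (proj₂ z-order))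

    order2⇒⟨z⟩≈ε⊎z : ∀ {x} → ⟨ z ⟩ x → x ≈ ε ⊎ x ≈ z
    order2⇒⟨z⟩≈ε⊎z x∈⟨z⟩ with proj₂ (proj₂ (proj₂ (⟨⟩-hasExactly z-order))) _ x∈⟨z⟩
    ... | zero     , x≈ε   = inj₁ x≈ε
    ... | suc zero , x≈z∙ε = inj₂ (trans x≈z∙ε (identityʳ z))

  lagrange : ∀ {p q} {K : Carrier → Set p} {H : Carrier → Set q} {k m} →
             IsSubgroup K → IsSubgroup H → (∀ {x} → K x → H x) →
             HasExactly (SameRightCoset K) H k → HasExactly _≈_ K m → HasExactly _≈_ H (k * m)
  lagrange {K = K} {H} {k} {m} K-sub H-sub K⊆H (f , f∈H , f-inj , f-cover) (g , g∈K , g-inj , g-cover) =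
    element ∘ remQuot m ,
    (λ i → element-∈ (remQuot {k} m i)) ,
    (λ i j eq → ≡.trans (≡.sym (combine-remQuot {k} m i))
                  (≡.trans (≡.cong (uncurry combine) (element-injective eq)) (combine-remQuot {k} m j))) ,
    cover
    where
    module K = IsSubgroup K-sub
    module H = IsSubgroup H-sub

    element : Fin k × Fin m → Carrier
    element (r , s) = g s ∙ f r

    element-∈ : ∀ rs → H (element rs)
    element-∈ (r , s) = H.∙-closed (K⊆H (g∈K s)) (f∈H r)

    same-coset : ∀ {r s r′ s′} → g s ∙ f r ≈ g s′ ∙ f r′ → g s ⁻¹ ∙ g s′ ≈ f r ∙ f r′ ⁻¹
    same-coset {r} {s} {r′} {s′} eq = begin
      g s ⁻¹ ∙ g s′                      ≈⟨ solve 3 (λ x y w → x :⁻¹ :∙ y ⊜ x :⁻¹ :∙ ((y :∙ w) :∙ w :⁻¹))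
                                                     refl (g s) (g s′) (f r′) ⟩
      g s ⁻¹ ∙ ((g s′ ∙ f r′) ∙ f r′ ⁻¹) ≈⟨ ∙-congˡ (∙-congʳ eq) ⟨
      g s ⁻¹ ∙ ((g s ∙ f r) ∙ f r′ ⁻¹)   ≈⟨ solve 3 (λ x y w → x :⁻¹ :∙ ((x :∙ y) :∙ w :⁻¹) ⊜ y :∙ w :⁻¹)
                                                     refl (g s) (f r) (f r′) ⟩
      f r ∙ f r′ ⁻¹                      ∎

    element-injective : ∀ {rs rs′} → element rs ≈ element rs′ → rs ≡ rs′
    element-injective {r , s} {r′ , s′} eq
      with f-inj r r′ (K.∈-resp-≈ (same-coset eq) (K.∙-closed (K.⁻¹-closed (g∈K s)) (g∈K s′)))
    ... | ≡.refl = ≡.cong (r ,_) (g-inj s s′ (∙-cancelʳ (f r) (g s) (g s′) eq))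

    cover : ∀ x → H x → ∃ λ i → x ≈ element (remQuot {k} m i)
    cover x x∈H with f-cover x x∈H
    ... | r , x~fr with g-cover _ x~fr
    ... | s , x∙fr⁻¹≈gs = combine r s , (begin
      x                                  ≈⟨ solve 2 (λ x y → x ⊜ (x :∙ y :⁻¹) :∙ y) refl x (f r) ⟩
      (x ∙ f r ⁻¹) ∙ f r                 ≈⟨ ∙-congʳ x∙fr⁻¹≈gs ⟩
      element (r , s)                    ≡⟨ ≡.cong element (remQuot-combine r s) ⟨
      element (remQuot m (combine r s))  ∎)

module _ {a ℓ : Level} (S : Setoid a ℓ) where
  open Setoid S

  HasExactly-≤ : ∀ {p} {P : Carrier → Set p} {m n} → HasExactly _≈_ P m → HasExactly _≈_ P n → m ≤ n
  HasExactly-≤ {P = P} {m} {n} (f , f∈P , f-inj , _) (g , _ , _ , g-cover) = injective⇒≤ index-injective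
    where
    index : Fin m → Fin n
    index i = proj₁ (g-cover (f i) (f∈P i))

    index-injective : ∀ {i j} → index i ≡ index j → i ≡ j
    index-injective {i} {j} eq = f-inj i j (trans (proj₂ (g-cover (f i) (f∈P i)))
      (trans (reflexive (≡.cong g eq)) (sym (proj₂ (g-cover (f j) (f∈P j))))))

  HasExactly-unique : ∀ {p} {P : Carrier → Set p} {m n} → HasExactly _≈_ P m → HasExactly _≈_ P n → m ≡ n
  HasExactly-unique A B = ≤-antisym (HasExactly-≤ A B) (HasExactly-≤ B A)

Fin2-cover : ∀ (x y w : Fin 2) → y ≢ w → x ≡ y ⊎ x ≡ w
Fin2-cover zero       zero       _          _   = inj₁ ≡.refl
Fin2-cover (suc zero) (suc zero) _          _   = inj₁ ≡.refl
Fin2-cover zero       (suc zero) zero       _   = inj₂ ≡.refl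
Fin2-cover (suc zero) zero       (suc zero) _   = inj₂ ≡.refl
Fin2-cover _          zero       zero       y≢w = contradiction ≡.refl y≢w
Fin2-cover _          (suc zero) (suc zero) y≢w = contradiction ≡.refl y≢w

-- In Cycle n the edges at v are v itself and its predecessor modulo n.
PrevEdge : ∀ {n} → Fin n → Fin n → Set
PrevEdge {n} v e = (toℕ v ≡ suc (toℕ e)) ⊎ ((toℕ v ≡ 0) × (suc (toℕ e) ≡ n))

PrevEdge-unique : ∀ {n} {v e e′ : Fin n} → PrevEdge v e → PrevEdge v e′ → e ≡ e′
PrevEdge-unique (inj₁ v≡1+e) (inj₁ v≡1+e′) =
  toℕ-injective (suc-injective (≡.trans (≡.sym v≡1+e) v≡1+e′))
PrevEdge-unique (inj₂ (_ , 1+e≡n)) (inj₂ (_ , 1+e′≡n)) =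
  toℕ-injective (suc-injective (≡.trans 1+e≡n (≡.sym 1+e′≡n)))
PrevEdge-unique (inj₁ v≡1+e) (inj₂ (v≡0 , _)) = contradiction (≡.trans (≡.sym v≡1+e) v≡0) λ ()
PrevEdge-unique (inj₂ (v≡0 , _)) (inj₁ v≡1+e′) = contradiction (≡.trans (≡.sym v≡1+e′) v≡0) λ ()

Cycle-≤2-incident : ∀ {n} {v e₁ e₂ e₃ : Fin n} → Graph._inc_ (Cycle n) v e₁ →
                    Graph._inc_ (Cycle n) v e₂ → Graph._inc_ (Cycle n) v e₃ →
                    e₁ ≡ e₂ ⊎ e₁ ≡ e₃ ⊎ e₂ ≡ e₃
Cycle-≤2-incident (inj₁ ≡.refl) (inj₁ ≡.refl) _             = inj₁ ≡.refl
Cycle-≤2-incident (inj₂ p)      (inj₂ q)      _             = inj₁ (PrevEdge-unique p q)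
Cycle-≤2-incident (inj₁ ≡.refl) (inj₂ _)      (inj₁ ≡.refl) = inj₂ (inj₁ ≡.refl)
Cycle-≤2-incident (inj₁ _)      (inj₂ q)      (inj₂ r)      = inj₂ (inj₂ (PrevEdge-unique q r))
Cycle-≤2-incident (inj₂ _)      (inj₁ ≡.refl) (inj₁ ≡.refl) = inj₂ (inj₂ ≡.refl)
Cycle-≤2-incident (inj₂ p)      (inj₁ _)      (inj₂ r)      = inj₂ (inj₁ (PrevEdge-unique p r))

module _ {a b : Level} {Γ : Graph a b} where
  open Graph Γ

  ≅K2⇒two-vertices : ∀ {m} → Γ ≅ K2 m → ∀ {u v} → ¬ u ≈V v → ∀ w → w ≈V u ⊎ w ≈V v
  ≅K2⇒two-vertices iso {u} {v} u≉v w =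
    Sum.map (fV-refl w u) (fV-refl w v) (Fin2-cover (fV w) (fV u) (fV v) (u≉v ∘ fV-refl u v))
    where open _≅_ iso

  ≅Cycle⇒≤2-incident : ∀ {n} → Γ ≅ Cycle n → ∀ {v e₁ e₂ e₃} → v inc e₁ → v inc e₂ → v inc e₃ →
                       e₁ ≈E e₂ ⊎ e₁ ≈E e₃ ⊎ e₂ ≈E e₃
  ≅Cycle⇒≤2-incident iso v∈e₁ v∈e₂ v∈e₃ =
    Sum.map (fE-refl _ _) (Sum.map (fE-refl _ _) (fE-refl _ _))
      (Cycle-≤2-incident (inc-pres _ _ v∈e₁) (inc-pres _ _ v∈e₂) (inc-pres _ _ v∈e₃))
    where open _≅_ iso

module CosetGraph {c ℓ : Level} (G : Group c ℓ) {H J : Group.Carrier G → Set ℓ}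
                  (H-sub : GroupLemmas.IsSubgroup G H) (J-sub : GroupLemmas.IsSubgroup G J) where
  open Group G
  open GroupDefs G
  open MonoidProperties monoid using (cancelˡ)
  open GroupLemmas G
  open GroupSolver G
  open SetoidReasoning setoid
  module H = IsSubgroup H-sub
  module J = IsSubgroup J-sub

  Γ : Graph c (c ⊔ ℓ)
  Γ = Cos H J

  open Graph Γ using (_inc_)

  inc⇒ : ∀ {u e} → u inc e → ∃ λ j → J j × j ∙ e H.~ u
  inc⇒ {u} {e} (j , h , j∈J , h∈H , eu⁻¹≈jh) = j ⁻¹ , J.⁻¹-closed j∈J , H.∈-resp-≈ (begin
    h                  ≈⟨ solve 2 (λ j h → h ⊜ j :⁻¹ :∙ (j :∙ h)) refl j h ⟩
    j ⁻¹ ∙ (j ∙ h)     ≈⟨ ∙-congˡ eu⁻¹≈jh ⟨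
    j ⁻¹ ∙ (e ∙ u ⁻¹)  ≈⟨ assoc _ _ _ ⟨
    (j ⁻¹ ∙ e) ∙ u ⁻¹  ∎) h∈H

  ⇒inc : ∀ {u e j} → J j → j ∙ e H.~ u → u inc e
  ⇒inc {u} {e} {j} j∈J je~u = j ⁻¹ , (j ∙ e) ∙ u ⁻¹ , J.⁻¹-closed j∈J , je~u ,
    solve 3 (λ j e u → e :∙ u :⁻¹ ⊜ j :⁻¹ :∙ ((j :∙ e) :∙ u :⁻¹)) refl j e u

  Cos-isAutAction : IsAutAction Γ G _∙_ _∙_
  Cos-isAutAction =
    (λ u → lift (H.~-reflexive (identityʳ u))) ,
    (λ u g h → lift (H.~-reflexive (assoc u g h))) ,
    (λ e → lift (J.~-reflexive (identityʳ e))) ,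
    (λ e g h → lift (J.~-reflexive (assoc e g h))) ,
    (λ g _ _ u~v → lift (H.~-∙ʳ g (lower u~v))) ,
    (λ g _ _ e~f → lift (J.~-∙ʳ g (lower e~f))) ,
    (λ g u e → InProd-resp (sym (cancel g u e)) , InProd-resp (cancel g u e))
    where
    InProd-resp : ∀ {x y} → x ≈ y → InProd J H x → InProd J H y
    InProd-resp x≈y (j , h , j∈J , h∈H , x≈jh) = j , h , j∈J , h∈H , trans (sym x≈y) x≈jh

    cancel : ∀ g u e → (e ∙ g) ∙ (u ∙ g) ⁻¹ ≈ e ∙ u ⁻¹
    cancel = solve 3 (λ g u e → (e :∙ g) :∙ (u :∙ g) :⁻¹ ⊜ e :∙ u :⁻¹) refl

  Cos-stabiliser-transitive : ∀ {α e e′} → α inc e → α inc e′ → ∃ λ g → α ∙ g H.~ α × e ∙ g J.~ e′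
  Cos-stabiliser-transitive {α} {e} {e′} α∈e α∈e′ with inc⇒ α∈e | inc⇒ α∈e′
  ... | j , j∈J , je~α | j′ , j′∈J , j′e′~α =
    (j ∙ e) ⁻¹ ∙ (j′ ∙ e′) ,
    H.~-translate _ (H.~-sym je~α) (H.~-sym j′e′~α) (cancelˡ (inverseʳ (j ∙ e)) (j′ ∙ e′)) ,
    J.~-translate _ (J.~-sym (J.∈⇒∙~ e j∈J)) (J.~-sym (J.∈⇒∙~ e′ j′∈J)) (cancelˡ (inverseʳ (j ∙ e)) (j′ ∙ e′))

module InvolutionCosetGraph {c ℓ : Level} (G : Group c ℓ) {H : Group.Carrier G → Set ℓ}
                            (H-sub : GroupLemmas.IsSubgroup G H) {z : Group.Carrier G}
                            (z-order : GroupDefs.HasOrder G z 2) (z∉H : ¬ H z) where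
  open Group G
  open GroupDefs G
  open GroupProperties G using (x∙y⁻¹≈ε⇒x≈y)
  open MonoidProperties monoid using (cancelˡ)
  open GroupLemmas G
  open GroupSolver G
  open SetoidReasoning setoid
  open CosetGraph G H-sub (⟨⟩-isSubgroup z-order) public
  open Graph Γ using (_inc_)

  K : Carrier → Set (c ⊔ ℓ)
  K = CapConj H z

  K-sub : IsSubgroup K
  K-sub = ∩-isSubgroup H-sub (Conj-isSubgroup H-sub z)

  module K = IsSubgroup K-sub

  z∈J : ⟨ z ⟩ z
  z∈J = + 1 , sym (identityʳ z)

  J∩H≈ε : ∀ {x} → ⟨ z ⟩ x → H x → x ≈ ε
  J∩H≈ε x∈J x∈H with order2⇒⟨z⟩≈ε⊎z z-order x∈J
  ... | inj₁ x≈ε = x≈ε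
  ... | inj₂ x≈z = contradiction (H.∈-resp-≈ x≈z x∈H) z∉H

  x≁z∙x : ∀ {x} → ¬ x H.~ z ∙ x
  x≁z∙x {x} x~zx =
    z∉H (H.∈-resp-≈ (solve 2 (λ x z → (x :∙ (z :∙ x) :⁻¹) :⁻¹ ⊜ z) refl x z) (H.⁻¹-closed x~zx))

  inc⇒ends : ∀ {u e} → u inc e → u H.~ e ⊎ u H.~ z ∙ e
  inc⇒ends u∈e with inc⇒ u∈e
  ... | j , j∈J , je~u with order2⇒⟨z⟩≈ε⊎z z-order j∈J
  ... | inj₁ j≈ε = inj₁ (H.~-sym (H.~-resp (trans (∙-congʳ j≈ε) (identityˡ _)) refl je~u))
  ... | inj₂ j≈z = inj₂ (H.~-sym (H.~-resp (∙-congʳ j≈z) refl je~u))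

  ends⇒inc : ∀ {u e} → u H.~ e ⊎ u H.~ z ∙ e → u inc e
  ends⇒inc (inj₁ u~e)  = ⇒inc J.ε-∈ (H.~-resp (sym (identityˡ _)) refl (H.~-sym u~e))
  ends⇒inc (inj₂ u~ze) = ⇒inc z∈J (H.~-sym u~ze)

  Cos-isProper : IsProperGraph Γ
  Cos-isProper e =
    e , z ∙ e , x≁z∙x ∘ lower ,
    ends⇒inc (inj₁ (H.~-reflexive refl)) , ends⇒inc (inj₂ (H.~-reflexive refl)) ,
    λ w w∈e → Sum.map lift lift (inc⇒ends w∈e)

  arc-normal-form : ∀ {u v e} → u inc e → v inc e → ¬ u H.~ v →
                    ∃ λ y → e J.~ y × u H.~ y × v H.~ z ∙ y
  arc-normal-form {e = e} u∈e v∈e u≁v with inc⇒ends u∈e | inc⇒ends v∈e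
  ... | inj₁ u~e  | inj₁ v~e  = contradiction (H.~-trans u~e (H.~-sym v~e)) u≁v
  ... | inj₁ u~e  | inj₂ v~ze = e , J.~-reflexive refl , u~e , v~ze
  ... | inj₂ u~ze | inj₁ v~e  = z ∙ e , J.~-sym (J.∈⇒∙~ e z∈J) , u~ze , H.~-resp refl (sym (cancelˡ (order2⇒z∙z≈ε z-order) e)) v~e
  ... | inj₂ u~ze | inj₂ v~ze = contradiction (H.~-trans u~ze (H.~-sym v~ze)) u≁v

  Cos-isArcTransitive : IsArcTransitive Γ G _∙_ _∙_
  Cos-isArcTransitive e u v e′ u′ v′ u∈e v∈e u≉v u′∈e′ v′∈e′ u′≉v′
    with arc-normal-form u∈e v∈e (u≉v ∘ lift) | arc-normal-form u′∈e′ v′∈e′ (u′≉v′ ∘ lift)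
  ... | y , e~y , u~y , v~zy | y′ , e′~y′ , u′~y′ , v′~zy′ =
    y ⁻¹ ∙ y′ ,
    lift (J.~-translate _ e~y e′~y′ (cancelˡ (inverseʳ y) y′)) ,
    lift (H.~-translate _ u~y u′~y′ (cancelˡ (inverseʳ y) y′)) ,
    lift (H.~-translate _ v~zy v′~zy′ (solve 3 (λ z y y′ → (z :∙ y) :∙ (y :⁻¹ :∙ y′) ⊜ z :∙ y′) refl z y y′))

  -- H z h u = H z h′ u iff h h′⁻¹ ∈ Hᶻ: the neighbours of H u are indexed by H/(H ∩ Hᶻ).
  z-coset⇒Conj : ∀ {x y u} → (z ∙ x) ∙ u H.~ (z ∙ y) ∙ u → Conj H z (x ∙ y ⁻¹)
  z-coset⇒Conj {x} {y} {u} zxu~zyu = _ , zxu~zyu ,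
    solve 4 (λ z x y u → x :∙ y :⁻¹ ⊜ (z :⁻¹ :∙ (((z :∙ x) :∙ u) :∙ ((z :∙ y) :∙ u) :⁻¹)) :∙ z) refl z x y u

  Conj⇒z-coset : ∀ {x y u} → Conj H z (x ∙ y ⁻¹) → (z ∙ x) ∙ u H.~ (z ∙ y) ∙ u
  Conj⇒z-coset {x} {y} {u} (w , w∈H , xy⁻¹≈wᶻ) = H.∈-resp-≈ (begin
    w                                  ≈⟨ solve 2 (λ z w → w ⊜ z :∙ ((z :⁻¹ :∙ w) :∙ z) :∙ z :⁻¹) refl z w ⟩
    z ∙ ((z ⁻¹ ∙ w) ∙ z) ∙ z ⁻¹        ≈⟨ ∙-congʳ (∙-congˡ xy⁻¹≈wᶻ) ⟨
    z ∙ (x ∙ y ⁻¹) ∙ z ⁻¹              ≈⟨ solve 4 (λ z x y u → z :∙ (x :∙ y :⁻¹) :∙ z :⁻¹ ⊜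
                                                  ((z :∙ x) :∙ u) :∙ ((z :∙ y) :∙ u) :⁻¹) refl z x y u ⟩
    ((z ∙ x) ∙ u) ∙ ((z ∙ y) ∙ u) ⁻¹   ∎) w∈H

  adjacent⇒ : ∀ {u v} → Adjacent Γ u v → ∃ λ h → H h × v H.~ (z ∙ h) ∙ u
  adjacent⇒ {u} {v} (u≉v , e , u∈e , v∈e) with arc-normal-form u∈e v∈e (u≉v ∘ lift)
  ... | y , _ , u~y , v~zy = y ∙ u ⁻¹ , H.~-sym u~y ,
    H.~-resp refl (solve 3 (λ z y u → z :∙ y ⊜ (z :∙ (y :∙ u :⁻¹)) :∙ u) refl z y u) v~zy

  ⇒adjacent : ∀ {u v h} → H h → v H.~ (z ∙ h) ∙ u → Adjacent Γ u v
  ⇒adjacent {u} {v} {h} h∈H v~zhu =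
    (λ u~v → x≁z∙x (H.~-trans (H.∈⇒∙~ u h∈H) (H.~-trans (lower u~v) v~z[hu]))) ,
    h ∙ u , ends⇒inc (inj₁ (H.~-sym (H.∈⇒∙~ u h∈H))) , ends⇒inc (inj₂ v~z[hu])
    where
    v~z[hu] : v H.~ z ∙ (h ∙ u)
    v~z[hu] = H.~-resp refl (assoc z h u) v~zhu

  Cos-hasValency : ∀ {k} → HasExactly (SameRightCoset K) H k → HasValency Γ k
  Cos-hasValency {k} (f , f∈H , f-inj , f-cover) u =
    neighbour , (λ i → ⇒adjacent (f∈H i) (H.~-reflexive refl)) , injective , cover
    where
    neighbour : Fin k → Carrier
    neighbour i = (z ∙ f i) ∙ u

    injective : ∀ i j → Graph._≈V_ Γ (neighbour i) (neighbour j) → i ≡ j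
    injective i j (lift nᵢ~nⱼ) = f-inj i j (H.∙-closed (f∈H i) (H.⁻¹-closed (f∈H j)) , z-coset⇒Conj nᵢ~nⱼ)

    cover : ∀ v → Adjacent Γ u v → ∃ λ i → Graph._≈V_ Γ v (neighbour i)
    cover v u-v =
      let (h , h∈H , v~zhu) = adjacent⇒ u-v
          (i , _ , h∙fᵢ⁻¹∈Hᶻ) = f-cover h h∈H
      in i , lift (H.~-trans v~zhu (Conj⇒z-coset h∙fᵢ⁻¹∈Hᶻ))

  edges-between : ∀ {m u v h} → HasExactly _≈_ K m → ¬ u H.~ v → H h → v H.~ (z ∙ h) ∙ u →
                  HasExactly (Graph._≈E_ Γ) (λ e → u inc e × v inc e) m
  edges-between {m} {u} {v} {h} (g , g∈K , g-inj , g-cover) u≁v h∈H v~zhu =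
    edge , (λ i → u∈edge i , v∈edge i) , injective , cover
    where
    edge : Fin m → Carrier
    edge i = (g i ∙ h) ∙ u

    u∈edge : ∀ i → u inc edge i
    u∈edge i = ends⇒inc (inj₁ (H.~-sym (H.∈⇒∙~ u (H.∙-closed (proj₁ (g∈K i)) h∈H))))

    v∈edge : ∀ i → v inc edge i
    v∈edge i = ends⇒inc (inj₂ (H.~-trans v~zhu (H.~-resp refl (assoc z (g i ∙ h) u)
      (Conj⇒z-coset (proj₂ (K.∈-resp-≈ gᵢ⁻¹≈h∙[gᵢ∙h]⁻¹ (K.⁻¹-closed (g∈K i))))))))
      where
      gᵢ⁻¹≈h∙[gᵢ∙h]⁻¹ : g i ⁻¹ ≈ h ∙ (g i ∙ h) ⁻¹
      gᵢ⁻¹≈h∙[gᵢ∙h]⁻¹ = solve 2 (λ x h → x :⁻¹ ⊜ h :∙ (x :∙ h) :⁻¹) refl (g i) h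

    injective : ∀ i j → Graph._≈E_ Γ (edge i) (edge j) → i ≡ j
    injective i j (lift eᵢ~eⱼ) = g-inj i j (x∙y⁻¹≈ε⇒x≈y _ _ (J∩H≈ε
      (J.∈-resp-≈ (solve 4 (λ x y h u → ((x :∙ h) :∙ u) :∙ ((y :∙ h) :∙ u) :⁻¹ ⊜ x :∙ y :⁻¹)
                          refl (g i) (g j) h u) eᵢ~eⱼ)
      (H.∙-closed (proj₁ (g∈K i)) (H.⁻¹-closed (proj₁ (g∈K j))))))

    through : ∀ {y} → u H.~ y → v H.~ z ∙ y → ∃ λ i → y ≈ edge i
    through {y} u~y v~zy =
      let (i , yu⁻¹h⁻¹≈gᵢ) = g-cover (y ∙ u ⁻¹ ∙ h ⁻¹) (H.∙-closed (H.~-sym u~y) (H.⁻¹-closed h∈H) ,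
                                                        z-coset⇒Conj (H.~-trans zyu⁻¹u~v v~zhu))
      in i , (begin
        y                             ≈⟨ solve 3 (λ y u h → y ⊜ ((y :∙ u :⁻¹ :∙ h :⁻¹) :∙ h) :∙ u) refl y u h ⟩
        ((y ∙ u ⁻¹ ∙ h ⁻¹) ∙ h) ∙ u   ≈⟨ ∙-congʳ (∙-congʳ yu⁻¹h⁻¹≈gᵢ) ⟩
        edge i                        ∎)
      where
      zyu⁻¹u~v : (z ∙ (y ∙ u ⁻¹)) ∙ u H.~ v
      zyu⁻¹u~v = H.~-resp (solve 3 (λ z y u → z :∙ y ⊜ (z :∙ (y :∙ u :⁻¹)) :∙ u) refl z y u) refl (H.~-sym v~zy)

    cover : ∀ e → u inc e × v inc e → ∃ λ i → Graph._≈E_ Γ e (edge i)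
    cover e (u∈e , v∈e) =
      let (y , e~y , u~y , v~zy) = arc-normal-form u∈e v∈e u≁v
          (i , y≈edgeᵢ) = through u~y v~zy
      in i , lift (J.~-resp refl y≈edgeᵢ e~y)

  Cos-hasEdgeMultiplicity : ∀ {m} → HasExactly _≈_ K m → HasEdgeMultiplicity Γ m
  Cos-hasEdgeMultiplicity K-enum u v u-v =
    let (h , h∈H , v~zhu) = adjacent⇒ u-v in edges-between K-enum (proj₁ u-v ∘ lift) h∈H v~zhu

  two-cosets⇒SameAsConj : (∀ x → x H.~ ε ⊎ x H.~ z) → SameAsConj H z
  two-cosets⇒SameAsConj cosets x = H⇒Hᶻ , Hᶻ⇒H
    where
    H⇒Hᶻ : H x → Conj H z x
    H⇒Hᶻ x∈H with cosets (z ∙ x)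
    ... | inj₁ zx~ε = contradiction (H.∈-resp-≈ (solve 2 (λ z x → ((z :∙ x) :∙ :ε :⁻¹) :∙ x :⁻¹ ⊜ z) refl z x)
                                                 (H.∙-closed zx~ε (H.⁻¹-closed x∈H))) z∉H
    ... | inj₂ zx~z = _ , zx~z , solve 2 (λ z x → x ⊜ (z :⁻¹ :∙ ((z :∙ x) :∙ z :⁻¹)) :∙ z) refl z x

    Hᶻ⇒H : Conj H z x → H x
    Hᶻ⇒H (w , w∈H , x≈wᶻ) with cosets x
    ... | inj₁ x~ε = H.∈-resp-≈ (solve 1 (λ x → x :∙ :ε :⁻¹ ⊜ x) refl x) x~ε
    ... | inj₂ x~z = contradiction (H.∈-resp-≈ z-as-product (H.∙-closed w∈H (H.⁻¹-closed x~z))) z∉H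
      where
      z-as-product : w ∙ (x ∙ z ⁻¹) ⁻¹ ≈ z
      z-as-product = begin
        w ∙ (x ∙ z ⁻¹) ⁻¹                   ≈⟨ ∙-congˡ (⁻¹-cong (∙-congʳ x≈wᶻ)) ⟩
        w ∙ (((z ⁻¹ ∙ w) ∙ z) ∙ z ⁻¹) ⁻¹    ≈⟨ solve 2 (λ z w → w :∙ (((z :⁻¹ :∙ w) :∙ z) :∙ z :⁻¹) :⁻¹ ⊜ z) refl z w ⟩
        z                                   ∎

  Cos≇K2 : ∀ {m} → ¬ SameAsConj H z → ¬ (Γ ≅ K2 m)
  Cos≇K2 H≠Hᶻ iso = H≠Hᶻ (two-cosets⇒SameAsConj λ x →
    Sum.map lower lower (≅K2⇒two-vertices iso (x≁z∙x ∘ H.~-resp refl (sym (identityʳ z)) ∘ lower) x))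

module RotaryCosetGraph {c ℓ : Level} (G : Group c ℓ) {a z : Group.Carrier G}
                        (rotary : GroupDefs.IsRotaryPair G a z) where
  open Group G
  open GroupDefs G
  open GroupProperties G using (x∙y⁻¹≈ε⇒x≈y)
  open GroupLemmas G
  open GroupSolver G
  open SetoidReasoning setoid

  open InvolutionCosetGraph G (⟨⟩-isSubgroup (proj₂ (proj₁ (proj₂ rotary))))
                              (proj₁ (proj₂ (proj₂ rotary))) (proj₂ (proj₂ (proj₂ rotary))) public
  open Graph Γ using (_inc_)

  stabiliser-cyclic : ∀ {α g} → α ∙ g H.~ α → ∃ λ m → g ≈ ((α ⁻¹ ∙ a) ∙ α) ^ℤ m
  stabiliser-cyclic {α} {g} (m , αgα⁻¹≈aᵐ) = m , (begin
    g                              ≈⟨ solve 2 (λ α g → g ⊜ (α :⁻¹ :∙ ((α :∙ g) :∙ α :⁻¹)) :∙ α) refl α g ⟩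
    (α ⁻¹ ∙ ((α ∙ g) ∙ α ⁻¹)) ∙ α  ≈⟨ ∙-congʳ (∙-congˡ αgα⁻¹≈aᵐ) ⟩
    (α ⁻¹ ∙ a ^ℤ m) ∙ α            ≈⟨ ^ℤ-conj α a m ⟨
    ((α ⁻¹ ∙ a) ∙ α) ^ℤ m          ∎)

  Cos-isStabCyclicTransitive : IsStabCyclicTransitive Γ G _∙_ _∙_
  Cos-isStabCyclicTransitive α =
    (λ e e′ α∈e α∈e′ → let (g , αg~α , eg~e′) = Cos-stabiliser-transitive α∈e α∈e′
                       in g , lift αg~α , lift eg~e′) ,
    (α ⁻¹ ∙ a) ∙ α , lift (H.∈-resp-≈ a≈α[α⁻¹aα]α⁻¹ (+ 1 , sym (identityʳ a))) ,
    λ g αg~α → let (m , g≈g₀ᵐ) = stabiliser-cyclic (lower αg~α)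
               in m , λ e _ → lift (J.~-reflexive (∙-congˡ g≈g₀ᵐ))
    where
    a≈α[α⁻¹aα]α⁻¹ : a ≈ (α ∙ ((α ⁻¹ ∙ a) ∙ α)) ∙ α ⁻¹
    a≈α[α⁻¹aα]α⁻¹ = solve 2 (λ α a → a ⊜ (α :∙ ((α :⁻¹ :∙ a) :∙ α)) :∙ α :⁻¹) refl α a

  ε-inc-aⁱ : ∀ i → ε inc (a ^ℕ i)
  ε-inc-aⁱ i = ends⇒inc (inj₁ (H.~-sym (H.~-resp (identityʳ _) refl (H.∈⇒∙~ ε (+ i , refl)))))

  module _ {n : ℕ} (a-order : HasOrder a n) (3≤n : 3 ≤ n) where

    small-powers-distinct : ∀ {i j} → i < 3 → j < 3 → Graph._≈E_ Γ (a ^ℕ i) (a ^ℕ j) → i ≡ j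
    small-powers-distinct {i} {j} i<3 j<3 (lift aⁱ~aʲ) =
      ^ℕ-injective a-order (<-≤-trans i<3 3≤n) (<-≤-trans j<3 3≤n) (x∙y⁻¹≈ε⇒x≈y _ _
        (J∩H≈ε aⁱ~aʲ (H.∙-closed (+ i , refl) (H.⁻¹-closed (+ j , refl)))))

    Cos-notCycle : ¬ IsSimpleCycle Γ
    Cos-notCycle (_ , _ , iso) with ≅Cycle⇒≤2-incident iso (ε-inc-aⁱ 0) (ε-inc-aⁱ 1) (ε-inc-aⁱ 2)
    ... | inj₁ a⁰≈a¹        = contradiction (small-powers-distinct z<s (s<s z<s) a⁰≈a¹) λ ()
    ... | inj₂ (inj₁ a⁰≈a²) = contradiction (small-powers-distinct z<s (s<s (s<s z<s)) a⁰≈a²) λ ()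
    ... | inj₂ (inj₂ a¹≈a²) = contradiction (small-powers-distinct (s<s z<s) (s<s (s<s z<s)) a¹≈a²) λ ()

  order≡index*order : ∀ {k m n} → HasExactly (SameRightCoset K) ⟨ a ⟩ k → HasExactly _≈_ K m →
                      HasOrder a n → n ≡ k * m
  order≡index*order hk hm a-order =
    HasExactly-unique setoid (⟨⟩-hasExactly a-order) (lagrange K-sub (⟨⟩-isSubgroup a-order) proj₁ hk hm)

lemma3p2 : {c ℓ : Level} (G : Group c ℓ) (a z : Group.Carrier G) →
    GroupDefs.IsRotaryPair G a z →
    (k m : ℕ) →
    -- k = |H : H ∩ H^z|  with H = ⟨ a ⟩
    HasExactly (GroupDefs.SameRightCoset G (GroupDefs.CapConj G (GroupDefs.⟨_⟩ G a) z))
               (GroupDefs.⟨_⟩ G a) k →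
    -- m = |H ∩ H^z|
    HasExactly (Group._≈_ G) (GroupDefs.CapConj G (GroupDefs.⟨_⟩ G a) z) m →
    IsProperGraph (GroupDefs.Cos G (GroupDefs.⟨_⟩ G a) (GroupDefs.⟨_⟩ G z)) ×
    IsVertexRotary (GroupDefs.Cos G (GroupDefs.⟨_⟩ G a) (GroupDefs.⟨_⟩ G z)) G
                   (Group._∙_ G) (Group._∙_ G) ×
    HasValency (GroupDefs.Cos G (GroupDefs.⟨_⟩ G a) (GroupDefs.⟨_⟩ G z)) k ×
    HasEdgeMultiplicity (GroupDefs.Cos G (GroupDefs.⟨_⟩ G a) (GroupDefs.⟨_⟩ G z)) m ×
    (∀ n → GroupDefs.HasOrder G a n → n ≡ k * m) ×
    (∀ n → GroupDefs.HasOrder G a n → 3 ≤ n →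
       ¬ GroupDefs.SameAsConj G (GroupDefs.⟨_⟩ G a) z →
       ¬ (GroupDefs.Cos G (GroupDefs.⟨_⟩ G a) (GroupDefs.⟨_⟩ G z) ≅ K2 m) ×
       ¬ IsSimpleCycle (GroupDefs.Cos G (GroupDefs.⟨_⟩ G a) (GroupDefs.⟨_⟩ G z)))
lemma3p2 G a z rotary k m index order =
  Cos-isProper ,
  (Cos-isAutAction , Cos-isArcTransitive , Cos-isStabCyclicTransitive) ,
  Cos-hasValency index ,
  Cos-hasEdgeMultiplicity order ,
  (λ n a-order → order≡index*order index order a-order) ,
  λ n a-order 3≤n H≠Hᶻ → Cos≇K2 H≠Hᶻ , Cos-notCycle a-order 3≤n
  where open RotaryCosetGraph G rotary
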